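{- Let $u,v\in\mathbb{N}$ and let $A$ be a $u\times v$ matrix with rational entries. Suppose that for every $CR$-set $B$ in $(\mathbb{Z},+)$, the set $\left\{\vec{y}\in\mathbb{Z}^{v}:A\vec{y}\in B^{u}\right\}$ is a $CR$-set in $(\mathbb{Z}^{v},+)$. Then for every essential $CR$-set $C$ in $(\mathbb{Z},+)$, the set $\left\{\vec{y}\in\mathbb{Z}^{v}:A\vec{y}\in C^{u}\right\}$ is an essential $CR$-set in $(\mathbb{Z}^{v},+)$.
   Context: $\mathbb{N}=\{1,2,3,\ldots\}$. Vectors are regarded as column vectors. Let $(S,+)$ be a commutative semigroup and $E\subseteq S$. $E$ is a $CR$-set (combinatorially rich set) in $S$ if and only if for each $k\in\mathbb{N}$ there exists $r\in\mathbb{N}$ such that for every $r\times k$ matrix $M=(m_{i,j})$ with entries from $S$ there exist $a\in S$ and a nonempty $H\subseteq\{1,2,\ldots,r\}$ such that for each $j\in\{1,2,\ldots,k\}$, $a+\sum_{t\in H}m_{t,j}\in E$. Let $\beta S$ be the Stone–Čech compactification of the discrete space $S$, viewed as the set of ultrafilters on $S$, with the operation extending $+$ given by: $E\in p+q$ if and only if $\{x\in S:-x+E\in q\}\in p$, where $-x+E=\{y\in S:x+y\in E\}$. For $E\subseteq S$, $\overline{E}=\{p\in\beta S:E\in p\}$. Let $CR(S)=\{p\in\beta S: \text{every } E\in p \text{ is a } CR\text{ -set in } S\}$. A set $E\subseteq S$ is an essential $CR$-set in $S$ if and only if there is an idempotent $p=p+p$ in $\overline{E}\cap CR(S)$. 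-}

module Defs where

open import Level using (0ℓ; suc)
open import Algebra.Core using (Op₂)
open import Algebra.Structures using (IsCommutativeSemigroup)
import Algebra.Properties.Monoid.Sum as MonoidSum
open import Data.Bool.Base using (true; false)
open import Data.Fin.Base using (Fin; zero) renaming (suc to fsuc)
open import Data.Fin.Subset using (Subset; Nonempty)
open import Data.Integer.Base as ℤ using (ℤ)
import Data.Integer.Properties as ℤₚ
open import Data.Nat.Base as ℕ using (ℕ)
open import Data.Product.Base using (_×_; _,_; ∃; ∃-syntax)
open import Data.Rational.Base as ℚ using (ℚ)
import Data.Rational.Properties as ℚₚ
open import Data.Sum.Base using (_⊎_; inj₁; inj₂)
open import Data.Vec.Base using (Vec; []; _∷_; lookup; zipWith)
open import Data.Vec.Properties using (zipWith-assoc; zipWith-comm)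
open import Function.Base using (_∘_)
open import Relation.Binary.PropositionalEquality
  using (_≡_; cong₂; isEquivalence)
open import Relation.Nullary.Negation.Core using (¬_)
open import Relation.Unary using (Pred; U; ∅; ∁; _∩_; _⊆_; _≐_)

-- The points of βS.  A subset of S is a predicate with values in Set.
record Ultrafilter (S : Set) : Set (suc 0ℓ) where
  field
    member     : Pred (Pred S 0ℓ) 0ℓ
    whole      : member U
    proper     : ¬ member ∅
    upward     : ∀ {E F : Pred S 0ℓ} → E ⊆ F → member E → member F
    intersect  : ∀ {E F : Pred S 0ℓ} → member E → member F → member (E ∩ F)
    ultra      : ∀ (E : Pred S 0ℓ) → member E ⊎ member (∁ E)

open Ultrafilter

module Semigroup {S : Set} {_+_ : Op₂ S}
                 (isCommutativeSemigroup : IsCommutativeSemigroup _≡_ _+_) where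

  -- a +Σ[ H ] f  is  a + ∑_{t ∈ H} f t, associated to the left.  Starting
  -- from a avoids the empty sum, which need not exist in a semigroup.
  infixl 6 _+Σ[_]_
  _+Σ[_]_ : ∀ {n} → S → Subset n → (Fin n → S) → S
  a +Σ[ [] ]        f = a
  a +Σ[ true  ∷ H ] f = (a + f zero) +Σ[ H ] (f ∘ fsuc)
  a +Σ[ false ∷ H ] f = a +Σ[ H ] (f ∘ fsuc)

  IsCR : Pred (Pred S 0ℓ) 0ℓ
  IsCR E =
    ∀ (k : ℕ) → 1 ℕ.≤ k →
    ∃[ r ] (1 ℕ.≤ r ×
      (∀ (M : Fin r → Fin k → S) →
       ∃[ a ] ∃[ H ] (Nonempty H ×
         (∀ (j : Fin k) → E (a +Σ[ H ] (λ t → M t j))))))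

  infixl 6 _⊕_
  _⊕_ : Op₂ (Ultrafilter S)
  (p ⊕ q) .member E = p .member (λ x → q .member (λ y → E (x + y)))
  (p ⊕ q) .whole = upward p (λ _ → whole q) (whole p)
  (p ⊕ q) .proper = proper p ∘ upward p (proper q)
  (p ⊕ q) .upward E⊆F = upward p (upward q E⊆F)
  (p ⊕ q) .intersect E∈ F∈ =
    upward p (λ (e , f) → intersect q e f) (intersect p E∈ F∈)
  (p ⊕ q) .ultra E with ultra p (λ x → q .member (λ y → E (x + y)))
  ... | inj₁ E∈ = inj₁ E∈
  ... | inj₂ E∉ = inj₂ (upward p complement E∉)
    where
    complement : ∁ (λ x → q .member (λ y → E (x + y)))
               ⊆ (λ x → q .member (λ y → ∁ E (x + y)))
    complement {x} ∉q with ultra q (λ y → E (x + y))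
    ... | inj₁ ∈q with () ← ∉q ∈q
    ... | inj₂ ∈q = ∈q

  IsIdempotent : Pred (Ultrafilter S) (suc 0ℓ)
  IsIdempotent p = p .member ≐ (p ⊕ p) .member

  CR : Pred (Ultrafilter S) (suc 0ℓ)
  CR p = p .member ⊆ IsCR

  IsEssentialCR : Pred (Pred S 0ℓ) (suc 0ℓ)
  IsEssentialCR E = ∃[ p ] (IsIdempotent p × p .member E × CR p)

module ℤ+ = Semigroup ℤₚ.+-isCommutativeSemigroup

ℤ^-isCommutativeSemigroup : ∀ v →
  IsCommutativeSemigroup (_≡_ {A = Vec ℤ v}) (zipWith ℤ._+_)
ℤ^-isCommutativeSemigroup v = record
  { isSemigroup = record
    { isMagma = record
      { isEquivalence = isEquivalence
      ; ∙-cong        = cong₂ (zipWith ℤ._+_)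
      }
    ; assoc = zipWith-assoc ℤₚ.+-assoc
    }
  ; comm = zipWith-comm ℤₚ.+-comm
  }

module ℤ^+ (v : ℕ) = Semigroup (ℤ^-isCommutativeSemigroup v)

open MonoidSum ℚₚ.+-0-monoid using (sum)

infixr 7 _·_
_·_ : ∀ {u v} → (Fin u → Fin v → ℚ) → Vec ℤ v → (Fin u → ℚ)
(A · y) i = sum (λ j → A i j ℚ.* (lookup y j ℚ./ 1))

-- { y ∈ ℤᵛ : A y ∈ Bᵘ }.  Since A y is a priori only rational, membership
-- of an entry in B includes its being an integer.
preimage : ∀ {u v} → (Fin u → Fin v → ℚ) → Pred ℤ 0ℓ → Pred (Vec ℤ v) 0ℓ
preimage A B y = ∀ i → ∃[ z ] (B z × (A · y) i ≡ z ℚ./ 1)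

{-# OPTIONS --safe #-}

-- Let p be an idempotent of CR(ℤ) containing C.  The sets preimage A B with
-- B ∈ p generate a filter, and so, because CR-sets are partition regular, do
-- the complements of the sets that are not CR; by hypothesis every member of
-- the first filter meets every member of the second.  Both filters F satisfy
-- E ∈ F ⇒ { x : -x + E ∈ F } ∈ F (for the first one this uses p = p + p and the
-- additivity of A), hence so does their join.  A filter that is maximal among
-- the proper filters with this property is an idempotent ultrafilter, by
-- Ellis's argument transcribed from closed subsemigroups of βS to filters.
--
-- Partition regularity comes from the Hales–Jewett theorem: if E ∪ F is CR,
-- apply it to the matrix whose columns are indexed by the words over the
-- columns of M, the column of a word being the sum of the columns of M it
-- spells, one block of rows for each letter; a monochromatic line of words
-- returns the columns of M, all within E or all within F.

module Submission where

open import Defs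
open import Level using (0ℓ; suc; Lift; lift; lower)
open import Algebra.Core using (Op₂)
open import Algebra.Definitions using (RightIdentity)
open import Algebra.Properties.CommutativeMonoid.Sum using (∑-distrib-+)
open import Algebra.Structures using (IsCommutativeSemigroup)
open import Axiom.ExcludedMiddle using (ExcludedMiddle)
open import Axiom.Extensionality.Propositional using (Extensionality)
open import Data.Bool.Base using (true; false)
open import Data.Empty using (⊥)
open import Data.Fin.Base
  using (Fin; zero; finToFun; funToFin; _↑ˡ_; _↑ʳ_; splitAt) renaming (suc to fsuc)
open import Data.Fin.Properties
  using (_≟_; any?; injective⇒≤; finToFun-funToFin; splitAt-↑ˡ; splitAt-↑ʳ)
open import Data.Fin.Subset as Subset using (Subset; Nonempty)
  renaming (_∈_ to _∈ₛ_)
open import Data.Integer.Base as ℤ using (ℤ)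
import Data.Integer.Properties as ℤₚ
open import Data.Maybe.Base as Maybe using (Maybe; just; nothing; fromMaybe)
open import Data.Nat.Base as ℕ using (ℕ; zero; _≤_; _^_; z≤n; s≤s)
open import Data.Nat.Properties using (1+n≰n; m≤n⇒m≤n+o; m^n>0)
open import Data.Product.Base using (_×_; _,_; ∃; ∃-syntax; proj₁; proj₂)
open import Data.Rational.Base as ℚ using (ℚ; toℚᵘ)
import Data.Rational.Properties as ℚₚ
open import Data.Rational.Unnormalised.Base as ℚᵘ using (mkℚᵘ)
import Data.Rational.Unnormalised.Properties as ℚᵘₚ
open import Data.Sum.Base using (_⊎_; inj₁; inj₂; [_,_]′)
open import Data.Unit.Base using (⊤)
open import Data.Vec.Base as Vec
  using (Vec; []; _∷_; _++_; lookup; replicate; tabulate; zipWith)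
open import Data.Vec.Membership.Propositional using (_∈_)
open import Data.Vec.Membership.Propositional.Properties using (∈-++⁺ˡ; ∈-++⁺ʳ; ∈-map⁺)
open import Data.Vec.Properties
  using (map-++; map-cong; map-∘; map-id; tabulate-cong; tabulate∘lookup; lookup-++ˡ;
         lookup-++ʳ; []=⇒lookup; lookup⇒[]=; lookup-zipWith; zipWith-identityʳ)
open import Data.Vec.Relation.Unary.Any using (here; there)
open import Function.Base using (_∘_; id)
open import Function.Definitions using (Injective)
open import Relation.Binary.PropositionalEquality
  using (_≡_; refl; sym; trans; cong; cong₂; subst; module ≡-Reasoning)
open import Relation.Nullary.Decidable.Core using (Dec; yes; no; map′; decidable-stable)
open import Relation.Nullary.Negation.Core using (¬_; contradiction)
open import Relation.Unary using (Pred; U; ∅; ∁; _∩_; _∪_; _⊆_; _≐_)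

open import Algebra.Properties.Monoid.Sum ℚₚ.+-0-monoid using (sum-cong-≗)

-- Zorn's lemma, from excluded middle

module Classical (em : ExcludedMiddle (suc 0ℓ)) where

  em₀ : ExcludedMiddle 0ℓ
  em₀ = map′ lower lift em

  -- Excluded middle makes Set impredicative: every type in Set₁ is
  -- logically equivalent to one in Set.
  truth : ∀ {P : Set₁} → Dec P → Set
  truth (yes _) = ⊤
  truth (no _)  = ⊥

  Resize : Set₁ → Set
  Resize P = truth (em {P})

  resize : ∀ {P} → P → Resize P
  resize {P} p with em {P}
  ... | yes _ = _
  ... | no ¬p = ¬p p

  unresize : ∀ {P} → Resize P → P
  unresize {P} r with em {P}
  ... | yes p = p

module Zorn (em : ExcludedMiddle (suc 0ℓ)) (ext : Extensionality (suc 0ℓ) (suc 0ℓ))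
            {X : Set₁} where
  open Classical em

  ⋃ : Pred (Pred X 0ℓ) 0ℓ → Pred X 0ℓ
  ⋃ 𝒞 x = Resize (∃[ C ] (𝒞 C × C x))

  Chain : Pred (Pred X 0ℓ) 0ℓ → Set₁
  Chain 𝒞 = ∀ {C D} → 𝒞 C → 𝒞 D → C ⊆ D ⊎ D ⊆ C

  ChainComplete : Pred (Pred X 0ℓ) (suc 0ℓ) → Set₁
  ChainComplete Φ = ∀ {𝒞} → Chain 𝒞 → ∃ 𝒞 → (∀ {C} → 𝒞 C → Φ C) → Φ (⋃ 𝒞)

  ⊆⋃ : ∀ {𝒞 C} → 𝒞 C → C ⊆ ⋃ 𝒞
  ⊆⋃ C∈ x∈ = resize (_ , C∈ , x∈)

  ⋃⊆ : ∀ {𝒞} {F : Pred X 0ℓ} → (∀ {C} → 𝒞 C → C ⊆ F) → ⋃ 𝒞 ⊆ F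
  ⋃⊆ 𝒞⊆ x∈ = let _ , C∈ , x∈C = unresize x∈ in 𝒞⊆ C∈ x∈C

  -- Equivalent predicates have equal normal forms, so an operation that
  -- factors through the normal form respects _≐_.
  normal : Pred X 0ℓ → Pred X 0ℓ
  normal F x = Resize (Lift (suc 0ℓ) (F x))

  ⊆normal : ∀ F → F ⊆ normal F
  ⊆normal F x∈ = resize (lift x∈)

  normal⊆ : ∀ F → normal F ⊆ F
  normal⊆ F x∈ = lower (unresize x∈)

  normal-cong : ∀ {F G} → F ≐ G → normal F ≡ normal G
  normal-cong {F} {G} (F⊆G , G⊆F) = ext same
    where
    same : ∀ x → normal F x ≡ normal G x
    same x with em {Lift (suc 0ℓ) (F x)} | em {Lift (suc 0ℓ) (G x)}
    ... | yes _        | yes _        = refl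
    ... | no _         | no _         = refl
    ... | yes (lift f) | no ¬g        = contradiction (lift (F⊆G f)) ¬g
    ... | no ¬f        | yes (lift g) = contradiction (lift (G⊆F g)) ¬f

  module _ (Φ : Pred (Pred X 0ℓ) (suc 0ℓ)) (complete : ChainComplete Φ)
           (F₀ : Pred X 0ℓ) (ΦF₀ : Φ F₀) where

    ProperExtension : Pred X 0ℓ → Set₁
    ProperExtension F = ∃[ G ] (Φ G × F ⊆ G × ¬ (G ⊆ F))

    -- The choice function of Zorn's lemma: the decision carries the extension `G`, which depends on
    -- `N` alone.
    choose : ∀ {N} → Dec (ProperExtension N) → Pred X 0ℓ → Pred X 0ℓ
    choose (yes (G , _)) F = G
    choose (no _)        F = F

    extend : Pred X 0ℓ → Pred X 0ℓ
    extend F = choose {normal F} em F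

    ⊆extend : ∀ {F} → F ⊆ extend F
    ⊆extend {F} with em {ProperExtension (normal F)}
    ... | yes (_ , _ , F⊆G , _) = λ x∈ → F⊆G (⊆normal F x∈)
    ... | no _                  = id

    choose-cong : ∀ {M N F G} → M ≡ N → F ⊆ G → choose {M} em F ⊆ choose {N} em G
    choose-cong {M} refl F⊆G with em {ProperExtension M}
    ... | yes _ = id
    ... | no _  = F⊆G

    extend-cong : ∀ {F G} → F ≐ G → extend F ⊆ extend G
    extend-cong F≐G = choose-cong (normal-cong F≐G) (proj₁ F≐G)

    -- The tower of the Bourbaki-Witt argument, in place of ordinals. `limit` admits any nonempty
    -- family; `tower-chain` shows afterwards that these are chains.
    data Tower : Pred X 0ℓ → Set₁ where
      base  : Tower F₀
      step  : ∀ {F} → Tower F → Tower (extend F)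
      limit : ∀ {𝒞} → ∃ 𝒞 → (∀ {C} → 𝒞 C → Tower C) → Tower (⋃ 𝒞)

    F₀⊆ : ∀ {F} → Tower F → F₀ ⊆ F
    F₀⊆ base                 = id
    F₀⊆ (step t)             = ⊆extend ∘ F₀⊆ t
    F₀⊆ (limit (_ , C∈) 𝒞⊆)  = ⊆⋃ C∈ ∘ F₀⊆ (𝒞⊆ C∈)

    -- An extreme point in the sense of Bourbaki-Witt: `extend` cannot jump over `F` from strictly
    -- below it.
    Extremal : Pred X 0ℓ → Set₁
    Extremal F = ∀ {G} → Tower G → G ⊆ F → F ⊆ G ⊎ extend G ⊆ F

    -- Induction on the tower of `G`. At a limit, either some member already contains `extend F`, or
    -- all members stay inside `F`.
    compare : ∀ {F} → Tower F → Extremal F → ∀ {G} → Tower G → G ⊆ F ⊎ extend F ⊆ G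
    compare f ef base = inj₁ (F₀⊆ f)
    compare f ef (step g) with compare f ef g
    ... | inj₂ fF⊆G = inj₂ (⊆extend ∘ fF⊆G)
    ... | inj₁ G⊆F with ef g G⊆F
    ...   | inj₁ F⊆G  = inj₂ (extend-cong (F⊆G , G⊆F))
    ...   | inj₂ gG⊆F = inj₁ gG⊆F
    compare {F} f ef (limit {𝒞} ne 𝒞⊆) with em {∃[ C ] (𝒞 C × extend F ⊆ C)}
    ... | yes (_ , C∈ , fF⊆C) = inj₂ (⊆⋃ C∈ ∘ fF⊆C)
    ... | no ¬∃ = inj₁ (⋃⊆ below)
      where
      below : ∀ {C} → 𝒞 C → C ⊆ F
      below C∈ with compare f ef (𝒞⊆ C∈)
      ... | inj₁ C⊆F  = C⊆F
      ... | inj₂ fF⊆C = contradiction (_ , C∈ , λ {x} → fF⊆C {x}) ¬∃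

    extremal : ∀ {F} → Tower F → Extremal F
    extremal base g G⊆F₀ = inj₁ (F₀⊆ g)
    extremal (step f) g G⊆fF with compare f (extremal f) g
    ... | inj₂ fF⊆G = inj₁ fF⊆G
    ... | inj₁ G⊆F with extremal f g G⊆F
    ...   | inj₁ F⊆G  = inj₂ (extend-cong (G⊆F , F⊆G))
    ...   | inj₂ gG⊆F = inj₂ (⊆extend ∘ gG⊆F)
    extremal l@(limit {𝒞} ne 𝒞⊆) {G} g G⊆⋃ with em {∃[ C ] (𝒞 C × ¬ (C ⊆ G))}
    ... | no ¬∃ = inj₁ (⋃⊆ λ C∈ {x} → decidable-stable em (λ C⊈G → ¬∃ (_ , C∈ , C⊈G)) {x})
    ... | yes (C , C∈ , C⊈G) with compare (𝒞⊆ C∈) (extremal (𝒞⊆ C∈)) g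
    ...   | inj₂ cC⊆G = contradiction (λ {x} → cC⊆G ∘ ⊆extend {x = x}) C⊈G
    ...   | inj₁ G⊆C with extremal (𝒞⊆ C∈) g G⊆C
    ...     | inj₁ C⊆G  = contradiction (λ {x} → C⊆G {x}) C⊈G
    ...     | inj₂ gG⊆C = inj₂ (⊆⋃ C∈ ∘ gG⊆C)

    tower-chain : ∀ {F G} → Tower F → Tower G → F ⊆ G ⊎ G ⊆ F
    tower-chain f g with compare f (extremal f) g
    ... | inj₁ G⊆F  = inj₂ G⊆F
    ... | inj₂ fF⊆G = inj₁ (fF⊆G ∘ ⊆extend)

    tower-Φ : ∀ {F} → Tower F → Φ F
    tower-Φ base = ΦF₀
    tower-Φ (step {F} t) with em {ProperExtension (normal F)}
    ... | yes (_ , ΦG , _) = ΦG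
    ... | no _             = tower-Φ t
    tower-Φ (limit ne 𝒞⊆) =
      complete (λ C∈ D∈ → tower-chain (𝒞⊆ C∈) (𝒞⊆ D∈)) ne (λ C∈ → tower-Φ (𝒞⊆ C∈))

    -- `Resize` brings the tower down to the level at which `limit` accepts it, so the union of the
    -- whole tower is again in the tower.
    top : Tower (⋃ (Resize ∘ Tower))
    top = limit (_ , resize base) unresize

    zorn : ∃[ M ] (Φ M × F₀ ⊆ M × (∀ {G} → Φ G → M ⊆ G → G ⊆ M))
    zorn = _ , tower-Φ top , F₀⊆ top , maximal
      where
      M = ⋃ (Resize ∘ Tower)
      -- The top absorbs its own extension, so `extend` cannot have chosen a proper one.
      extend⊆ : extend M ⊆ M
      extend⊆ = ⊆⋃ (resize (step top))
      maximal : ∀ {G} → Φ G → M ⊆ G → G ⊆ M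
      maximal {G} ΦG M⊆G = decidable-stable {A = G ⊆ _} em (λ G⊈M →
        stuck (G , ΦG , (λ x∈ → M⊆G (normal⊆ M x∈)) , λ G⊆M → G⊈M (λ x∈ → normal⊆ M (G⊆M x∈))))
        where
        stuck : ¬ ProperExtension (normal M)
        stuck e with em {ProperExtension (normal M)} | extend⊆
        ... | no ¬e                     | _    = ¬e e
        ... | yes (_ , _ , _ , H⊈M) | H⊆M = H⊈M λ x∈ → ⊆normal M (H⊆M x∈)

-- Idempotent filters

open Ultrafilter using (member)

record IsFilter {S : Set} (F : Pred (Pred S 0ℓ) 0ℓ) : Set₁ where
  field
    whole     : F U
    upward    : ∀ {A B} → A ⊆ B → F A → F B
    intersect : ∀ {A B} → F A → F B → F (A ∩ B)

Proper : {S : Set} → Pred (Pred S 0ℓ) 0ℓ → Set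
Proper F = ¬ F ∅

not-both : {S : Set} (p : Ultrafilter S) (E : Pred S 0ℓ) → member p E → ¬ member p (∁ E)
not-both p E E∈ ∁E∈ = proper (upward (λ (e , ¬e) → ¬e e) (intersect {E} {∁ E} E∈ ∁E∈))
  where open Ultrafilter p

module FilterProperties (em : ExcludedMiddle (suc 0ℓ)) (ext : Extensionality (suc 0ℓ) (suc 0ℓ))
                        {S : Set} where
  open Classical em
  open Zorn em ext {Pred S 0ℓ}

  ⋃-isFilter : ∀ {𝒞} → Chain 𝒞 → ∃ 𝒞 → (∀ {C} → 𝒞 C → IsFilter C) → IsFilter (⋃ 𝒞)
  ⋃-isFilter {𝒞} chain (_ , C∈) filter = record
    { whole     = ⊆⋃ C∈ (IsFilter.whole (filter C∈))
    ; upward    = λ A⊆B A∈ → let _ , D∈ , A∈D = unresize A∈ in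
                    ⊆⋃ D∈ (IsFilter.upward (filter D∈) A⊆B A∈D)
    ; intersect = λ A∈ B∈ → let _ , D∈ , A∈D = unresize A∈
                                _ , E∈ , B∈E = unresize B∈
                            in common D∈ E∈ A∈D B∈E (chain D∈ E∈)
    }
    where
    common : ∀ {D E A B} → 𝒞 D → 𝒞 E → D A → E B → D ⊆ E ⊎ E ⊆ D → ⋃ 𝒞 (A ∩ B)
    common D∈ E∈ A∈D B∈E (inj₁ D⊆E) =
      ⊆⋃ E∈ (IsFilter.intersect (filter E∈) (D⊆E A∈D) B∈E)
    common D∈ E∈ A∈D B∈E (inj₂ E⊆D) =
      ⊆⋃ D∈ (IsFilter.intersect (filter D∈) A∈D (E⊆D B∈E))

  ⋃-proper : ∀ {𝒞} → (∀ {C} → 𝒞 C → Proper C) → Proper (⋃ 𝒞)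
  ⋃-proper proper ∅∈ = let _ , C∈ , ∅∈C = unresize ∅∈ in proper C∈ ∅∈C

  infixr 6 _∨_
  _∨_ : (F G : Pred (Pred S 0ℓ) 0ℓ) → Pred (Pred S 0ℓ) 0ℓ
  (F ∨ G) D = Resize (∃[ A ] ∃[ B ] (F A × G B × A ∩ B ⊆ D))

  ∨-proper : ∀ {F G} → (∀ {A B} → F A → G B → ¬ (A ∩ B ⊆ ∅)) → Proper (F ∨ G)
  ∨-proper meets ∅∈ = let _ , _ , A∈ , B∈ , A∩B⊆∅ = unresize ∅∈ in meets A∈ B∈ A∩B⊆∅

  module _ {F G : Pred (Pred S 0ℓ) 0ℓ} (isF : IsFilter F) (isG : IsFilter G) where
    private
      module F = IsFilter isF
      module G = IsFilter isG

    ∨-isFilter : IsFilter (F ∨ G)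
    ∨-isFilter = record
      { whole     = resize (_ , _ , F.whole , G.whole , _)
      ; upward    = λ D⊆E D∈ → let _ , _ , A∈ , B∈ , A∩B⊆D = unresize D∈ in
                      resize (_ , _ , A∈ , B∈ , λ {x} x∈ → D⊆E {x} (A∩B⊆D x∈))
      ; intersect = λ D∈ E∈ →
          let _ , _ , A∈ , B∈ , A∩B⊆D = unresize D∈
              _ , _ , A′∈ , B′∈ , A′∩B′⊆E = unresize E∈
          in resize (_ , _ , F.intersect A∈ A′∈ , G.intersect B∈ B′∈ ,
               λ {x} ((a , a′) , (b , b′)) → A∩B⊆D {x} (a , b) , A′∩B′⊆E {x} (a′ , b′))
      }

    ⊆∨ˡ : F ⊆ F ∨ G
    ⊆∨ˡ A∈ = resize (_ , _ , A∈ , G.whole , λ {x} → proj₁)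

    ⊆∨ʳ : G ⊆ F ∨ G
    ⊆∨ʳ B∈ = resize (_ , _ , F.whole , B∈ , λ {x} → proj₂)

  principal-isFilter : ∀ (A : Pred S 0ℓ) → IsFilter (λ B → A ⊆ B)
  principal-isFilter A = record
    { whole     = _
    ; upward    = λ B⊆C A⊆B a → B⊆C (A⊆B a)
    ; intersect = λ A⊆B A⊆C a → A⊆B a , A⊆C a
    }

  ultrafilter-extension : ∀ {F} → IsFilter F → Proper F →
                          ∃[ q ] (F ⊆ member {S} q)
  ultrafilter-extension {F} isF properF
    with M , (isM , properM) , F⊆M , maximal ←
      zorn (λ G → IsFilter G × Proper G)
           (λ chain ne Φ → ⋃-isFilter chain ne (proj₁ ∘ Φ) , ⋃-proper (proj₂ ∘ Φ))
           F (isF , properF)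
    = record
      { member    = M
      ; whole     = M.whole
      ; proper    = properM
      ; upward    = M.upward
      ; intersect = M.intersect
      ; ultra     = ultra
      } , F⊆M
    where
    module M = IsFilter isM
    ultra : ∀ E → M E ⊎ M (∁ E)
    ultra E with em₀ {M E}
    ... | yes E∈ = inj₁ E∈
    ... | no  E∉ = inj₂ (maximal (∨-isFilter isM isE , proper) (⊆∨ˡ isM isE)
                                 (⊆∨ʳ isM isE id))
      where
      isE = principal-isFilter (∁ E)
      proper : Proper (M ∨ (λ B → ∁ E ⊆ B))
      -- An `A` in `M` disjoint from `∁ E` would be a subset of `E` and put `E` into `M`.
      proper = ∨-proper λ A∈ ∁E⊆B A∩B⊆∅ → E∉ (M.upward
        (λ a → decidable-stable em₀ λ ¬e → A∩B⊆∅ (a , ∁E⊆B ¬e)) A∈)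

-- Ellis's theorem for filters

module IdempotentExtension (em : ExcludedMiddle (suc 0ℓ)) (ext : Extensionality (suc 0ℓ) (suc 0ℓ))
       {S : Set} {_+_ : Op₂ S}
       (isCommutativeSemigroup : IsCommutativeSemigroup _≡_ _+_) where
  open Classical em
  open Zorn em ext {Pred S 0ℓ}
  open FilterProperties em ext {S}
  open Semigroup isCommutativeSemigroup using (IsIdempotent; _⊕_)
  open IsCommutativeSemigroup isCommutativeSemigroup using (assoc)

  infixl 7 _⊙_
  _⊙_ : (F G : Pred (Pred S 0ℓ) 0ℓ) → Pred (Pred S 0ℓ) 0ℓ
  (F ⊙ G) E = F (λ x → G (λ y → E (x + y)))

  -- The inclusion makes the closed set of ultrafilters containing `F` a subsemigroup of βS.
  record IsIdempotentFilter (F : Pred (Pred S 0ℓ) 0ℓ) : Set₁ where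
    field
      isFilter   : IsFilter F
      idempotent : F ⊆ F ⊙ F
    open IsFilter isFilter public

  open IsIdempotentFilter using (isFilter; idempotent)

  ⋃-isIdempotentFilter : ∀ {𝒞} → Chain 𝒞 → ∃ 𝒞 →
    (∀ {C} → 𝒞 C → IsIdempotentFilter C) → IsIdempotentFilter (⋃ 𝒞)
  ⋃-isIdempotentFilter chain ne isC = record
    { isFilter   = ⋃-isFilter chain ne (isFilter ∘ isC)
    ; idempotent = λ E∈ → let C , C∈ , E∈C = unresize E∈
                              module C = IsIdempotentFilter (isC C∈)
                          in ⊆⋃ C∈ (C.upward (⊆⋃ C∈) (C.idempotent E∈C))
    }

  ∨-isIdempotentFilter : ∀ {F G} → IsIdempotentFilter F → IsIdempotentFilter G →
                         IsIdempotentFilter (F ∨ G)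
  ∨-isIdempotentFilter isF isG = record
    { isFilter   = ∨-isFilter (isFilter isF) (isFilter isG)
    ; idempotent = λ D∈ → let _ , _ , A∈ , B∈ , A∩B⊆D = unresize D∈ in
        resize (_ , _ , idempotent isF A∈ , idempotent isG B∈ , λ {x} (a , b) →
          resize (_ , _ , a , b , λ {y} ab → A∩B⊆D {x + y} ab))
    }

  -- `M` stands for a minimal closed subsemigroup T of βS and `q` for a point of T. Ellis's
  -- argument: T + q is all of T, and then so is the set of p in T with p + q = q.
  module Maximal {M : Pred (Pred S 0ℓ) 0ℓ} (isM : IsIdempotentFilter M)
    (maximal : ∀ {G} → IsIdempotentFilter G → Proper G → M ⊆ G → G ⊆ M)
    (q : Ultrafilter S) (M⊆q : M ⊆ member q) where
    private
      module M = IsIdempotentFilter isM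
      module q = Ultrafilter q

    M⊙q-isFilter : IsFilter (M ⊙ q.member)
    M⊙q-isFilter = record
      { whole     = M.upward (λ _ → q.whole) M.whole
      ; upward    = λ A⊆B → M.upward (q.upward A⊆B)
      ; intersect = λ A∈ B∈ → M.upward (λ (a , b) → q.intersect a b) (M.intersect A∈ B∈)
      }

    -- The hypothesis speaks of sums s + w with s along `M` and w along `q`. Two uses of idempotency
    -- split s as x + (y + z), and `M⊆q` lets y run along `q`.
    M⊙q-idempotent : M ⊙ q.member ⊆ (M ⊙ q.member) ⊙ (M ⊙ q.member)
    M⊙q-idempotent {E} E∈ =
      M.upward (λ A∈ → q.upward (M.upward (q.upward reassociate)) (M⊆q (M.idempotent A∈)))
        (M.idempotent E∈)
      where
      reassociate : ∀ {x y z w} → E ((x + (y + z)) + w) → E ((x + y) + (z + w))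
      reassociate {x} {y} {z} {w} = subst E
        (trans (cong (_+ w) (sym (assoc x y z))) (assoc (x + y) z w))

    M⊙q⊆M : M ⊙ q.member ⊆ M
    M⊙q⊆M = maximal
      (record { isFilter = M⊙q-isFilter ; idempotent = λ {E} → M⊙q-idempotent {E} })
      (λ ∅∈ → q.proper (M⊆q (M.upward q.proper ∅∈)))
      (λ E∈ → M.upward M⊆q (M.idempotent E∈))

    -- The filter of the closed subsemigroup of all p with p + q = q.
    Stabiliser : Pred (Pred S 0ℓ) 0ℓ
    Stabiliser D = Resize (∃[ E ] (q.member E × (λ x → q.member (λ y → E (x + y))) ⊆ D))

    stabiliser-isIdempotentFilter : IsIdempotentFilter Stabiliser
    stabiliser-isIdempotentFilter = record
      { isFilter = record
        { whole     = resize (_ , q.whole , _)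
        ; upward    = λ A⊆B A∈ → let _ , E∈ , E⊆A = unresize A∈ in
                        resize (_ , E∈ , λ {x} x∈ → A⊆B {x} (E⊆A x∈))
        ; intersect = λ A∈ B∈ →
            let _ , D∈ , D⊆A = unresize A∈
                _ , E∈ , E⊆B = unresize B∈
            in resize (_ , q.intersect D∈ E∈ , λ {x} x∈ →
                 D⊆A {x} (q.upward proj₁ x∈) , E⊆B {x} (q.upward proj₂ x∈))
        }
      ; idempotent = λ D∈ → let E , E∈ , E⊆D = unresize D∈ in
          -- For x with -x + E in `q`, this translate is itself a member of `q`, and it generates
          -- the set required for y.
          resize (E , E∈ , λ {x} x∈ → resize (_ , x∈ , λ {y} y∈ →
            E⊆D (q.upward (λ {z} → subst E (sym (assoc x y z))) y∈)))
      }

    -- Since q lies in T + q, some p in T has p + q = q. For filters: if `A` misses every x with -x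
    -- + E in `q`, then `∁ E` lies in `M ⊙ q.member`, hence in `M` and in `q`, against `E` in `q`.
    M∨stabiliser-proper : Proper (M ∨ Stabiliser)
    M∨stabiliser-proper = ∨-proper disjoint
      where
      disjoint : ∀ {A B} → M A → Stabiliser B → ¬ (A ∩ B ⊆ ∅)
      disjoint {A} A∈ B∈ A∩B⊆∅ = not-both q E E∈ (M⊆q (M⊙q⊆M {∁ E} (M.upward avoid A∈)))
        where
        E = proj₁ (unresize B∈)
        E∈ = proj₁ (proj₂ (unresize B∈))
        E⊆B = proj₂ (proj₂ (unresize B∈))
        avoid : A ⊆ (λ x → q.member (λ y → ∁ E (x + y)))
        avoid {x} a with q.ultra (λ y → E (x + y))
        ... | inj₁ x∈ = contradiction (a , E⊆B x∈) A∩B⊆∅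
        ... | inj₂ x∉ = x∉

    -- Maximality puts `Stabiliser` inside `M`, so the x with -x + E in `q` form a member of `M`;
    -- that is, `E` is in `M ⊙ q.member`. Hence `M` and `q` coincide.
    q⊆M : q.member ⊆ M
    q⊆M E∈ = M⊙q⊆M (maximal (∨-isIdempotentFilter isM stabiliser-isIdempotentFilter)
      M∨stabiliser-proper
      (⊆∨ˡ M.isFilter (isFilter stabiliser-isIdempotentFilter))
      (⊆∨ʳ M.isFilter (isFilter stabiliser-isIdempotentFilter) (resize (_ , E∈ , λ {x} → id))))

    q-idempotent : IsIdempotent q
    q-idempotent = q⊆q⊕q , q⊕q⊆q
      where
      q⊆q⊕q : q.member ⊆ member (q ⊕ q)
      q⊆q⊕q E∈ = M⊆q (M.upward M⊆q (M.idempotent (q⊆M E∈)))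
      q⊕q⊆q : member (q ⊕ q) ⊆ q.member
      q⊕q⊆q {E} E∈ with q.ultra E
      ... | inj₁ E∈q = E∈q
      ... | inj₂ E∉q = contradiction (q⊆q⊕q E∉q) (not-both (q ⊕ q) E E∈)

  idempotent-extension : ∀ {F} → IsIdempotentFilter F → Proper F →
                         ∃[ q ] (IsIdempotent q × F ⊆ member q)
  idempotent-extension {F} isF properF
    with M , (isM , properM) , F⊆M , maximal ←
      zorn (λ G → IsIdempotentFilter G × Proper G)
           (λ chain ne Φ → ⋃-isIdempotentFilter chain ne (proj₁ ∘ Φ) , ⋃-proper (proj₂ ∘ Φ))
           F (isF , properF)
    with q , M⊆q ← ultrafilter-extension (isFilter isM) properM
    = q , Maximal.q-idempotent isM (λ isG properG → maximal (isG , properG)) q M⊆q ,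
      λ E∈ → M⊆q (F⊆M E∈)

-- The Hales–Jewett theorem

Word : ℕ → ℕ → Set
Word k n = Vec (Fin k) n

-- A combinatorial line, with nothing at its moving coordinates.
Line : ℕ → ℕ → Set
Line k n = Vec (Maybe (Fin k)) n

infix 30 _⟨_⟩
_⟨_⟩ : ∀ {k n} → Line k n → Fin k → Word k n
L ⟨ x ⟩ = Vec.map (fromMaybe x) L

Monochromatic : ∀ {k n r} → (Word k n → Fin r) → Line k n → Set
Monochromatic c L = nothing ∈ L × ∃[ γ ] (∀ x → c (L ⟨ x ⟩) ≡ γ)

HalesJewett : ℕ → ℕ → ℕ → Set
HalesJewett k r n = ∀ (c : Word k n → Fin r) → ∃ (Monochromatic c)

constant : ∀ {k n} → Word k n → Line k n
constant = Vec.map just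

constant-⟨⟩ : ∀ {k n} (w : Word k n) x → constant w ⟨ x ⟩ ≡ w
constant-⟨⟩ w x = trans (sym (map-∘ _ _ w)) (map-id w)

++-⟨⟩ : ∀ {k m n} (L : Line k m) (M : Line k n) x →
        (L ++ M) ⟨ x ⟩ ≡ L ⟨ x ⟩ ++ M ⟨ x ⟩
++-⟨⟩ L M x = map-++ (fromMaybe x) L M

-- The old letters are renamed by `fsuc`, so the line gains one new point, at the letter `zero`.
addLetter : ∀ {k n} → Line k n → Line (ℕ.suc k) n
addLetter = Vec.map (Maybe.map fsuc)

addLetter-⟨suc⟩ : ∀ {k n} (L : Line k n) x →
                  addLetter L ⟨ fsuc x ⟩ ≡ Vec.map fsuc (L ⟨ x ⟩)
addLetter-⟨suc⟩ L x = begin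
  addLetter L ⟨ fsuc x ⟩                           ≡⟨ map-∘ _ _ L ⟨
  Vec.map (fromMaybe (fsuc x) ∘ Maybe.map fsuc) L  ≡⟨ map-cong (λ { (just _) → refl ; nothing → refl }) L ⟩
  Vec.map (fsuc ∘ fromMaybe x) L                   ≡⟨ map-∘ _ _ L ⟩
  Vec.map fsuc (L ⟨ x ⟩)                           ∎
  where open ≡-Reasoning

code : ∀ {k n} → Word k n → Fin (k ^ n)
code = funToFin ∘ lookup

decode : ∀ {k n} → Fin (k ^ n) → Word k n
decode = tabulate ∘ finToFun

decode-code : ∀ {k n} (w : Word k n) → decode (code w) ≡ w
decode-code w = trans (tabulate-cong (finToFun-funToFin (lookup w))) (tabulate∘lookup w)

-- The letter zero is the one the lines are focused at.
record Focused {k n r} (c : Word (ℕ.suc k) n → Fin r) (s : ℕ) : Set where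
  field
    focus            : Word (ℕ.suc k) n
    line             : Fin s → Line (ℕ.suc k) n
    moving           : ∀ i → nothing ∈ line i
    focused          : ∀ i → line i ⟨ zero ⟩ ≡ focus
    colour           : Fin s → Fin r
    coloured         : ∀ i x → c (line i ⟨ fsuc x ⟩) ≡ colour i
    colour-injective : Injective _≡_ _≡_ colour

-- The situation once Hales-Jewett for the old letters has been applied to the first `m`
-- coordinates: along `L` the colour depends only on the tail `w`, through `c′`.
module _ {k r m n} (c : Word (ℕ.suc k) (m ℕ.+ n) → Fin r)
         (L : Line k m) (L-moving : nothing ∈ L) (c′ : Word (ℕ.suc k) n → Fin r)
         (c-L : ∀ x w → c (Vec.map fsuc (L ⟨ x ⟩) ++ w) ≡ c′ w) where

  c-addLetter : ∀ (M : Line (ℕ.suc k) n) x →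
                c ((addLetter L ++ M) ⟨ fsuc x ⟩) ≡ c′ (M ⟨ fsuc x ⟩)
  c-addLetter M x = begin
    c ((addLetter L ++ M) ⟨ fsuc x ⟩)              ≡⟨ cong c (++-⟨⟩ (addLetter L) M _) ⟩
    c (addLetter L ⟨ fsuc x ⟩ ++ M ⟨ fsuc x ⟩)     ≡⟨ cong (λ w → c (w ++ _)) (addLetter-⟨suc⟩ L x) ⟩
    c (Vec.map fsuc (L ⟨ x ⟩) ++ M ⟨ fsuc x ⟩)     ≡⟨ c-L x _ ⟩
    c′ (M ⟨ fsuc x ⟩)                              ∎
    where open ≡-Reasoning

  lift-monochromatic : Fin k → ∃ (Monochromatic c′) → ∃ (Monochromatic c)
  lift-monochromatic x₀ (M , M-moving , γ , c′-M) =
    constant w ++ M , ∈-++⁺ʳ (constant w) M-moving , γ , λ x → begin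
      c ((constant w ++ M) ⟨ x ⟩)         ≡⟨ cong c (++-⟨⟩ (constant w) M x) ⟩
      c (constant w ⟨ x ⟩ ++ M ⟨ x ⟩)     ≡⟨ cong (λ v → c (v ++ _)) (constant-⟨⟩ w x) ⟩
      c (w ++ M ⟨ x ⟩)                    ≡⟨ c-L x₀ _ ⟩
      c′ (M ⟨ x ⟩)                        ≡⟨ c′-M x ⟩
      γ                                   ∎
    where
    open ≡-Reasoning
    w = Vec.map fsuc (L ⟨ x₀ ⟩)

  -- If the focus has the colour of one of the lines, that line is monochromatic with its point at
  -- `zero` included. Otherwise every line is prolonged by `addLetter L`, and the line moving only
  -- within `L` contributes the colour of the focus as a new one.
  lift-focused : ∀ {s} → Focused c′ s → ∃ (Monochromatic c′) ⊎ Focused c (ℕ.suc s)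
  lift-focused {s} F with any? (λ i → c′ (Focused.focus F) ≟ Focused.colour F i)
  ... | yes (i , c′f≡) = inj₁ (line i , moving i , colour i , mono)
    where
    open Focused F
    mono : ∀ x → c′ (line i ⟨ x ⟩) ≡ colour i
    mono zero     = trans (cong c′ (focused i)) c′f≡
    mono (fsuc x) = coloured i x
  ... | no c′f≢ = inj₂ record
    { focus            = addLetter L ⟨ zero ⟩ ++ focus
    ; line             = λ i → addLetter L ++ tail i
    ; moving           = λ i → ∈-++⁺ˡ (∈-map⁺ _ L-moving)
    ; focused          = λ i → trans (++-⟨⟩ (addLetter L) (tail i) zero)
                                     (cong (addLetter L ⟨ zero ⟩ ++_) (tail-focused i))
    ; colour           = colour′
    ; coloured         = λ i x → trans (c-addLetter (tail i) x) (tail-coloured i x)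
    ; colour-injective = colour′-injective
    }
    where
    open Focused F
    tail : Fin (ℕ.suc s) → Line (ℕ.suc k) n
    tail zero     = constant focus
    tail (fsuc i) = line i
    tail-focused : ∀ i → tail i ⟨ zero ⟩ ≡ focus
    tail-focused zero     = constant-⟨⟩ focus zero
    tail-focused (fsuc i) = focused i
    colour′ : Fin (ℕ.suc s) → Fin r
    colour′ zero     = c′ focus
    colour′ (fsuc i) = colour i
    tail-coloured : ∀ i x → c′ (tail i ⟨ fsuc x ⟩) ≡ colour′ i
    tail-coloured zero     x = cong c′ (constant-⟨⟩ focus _)
    tail-coloured (fsuc i) x = coloured i x
    colour′-injective : Injective _≡_ _≡_ colour′
    colour′-injective {zero}   {zero}   _  = refl
    colour′-injective {zero}   {fsuc j} eq = contradiction (j , eq) c′f≢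
    colour′-injective {fsuc i} {zero}   eq = contradiction (i , sym eq) c′f≢
    colour′-injective {fsuc i} {fsuc j} eq = cong fsuc (colour-injective eq)

-- Colour focusing, by induction on `s`. The tail length `n` is fixed first; `m` is then taken for
-- as many colours as there are colourings of the tails, so that a prefix can be coloured by its
-- whole `profile`.
focusing : ∀ k r → (∀ q → ∃ (HalesJewett (ℕ.suc k) q)) → ∀ s →
           ∃[ n ] (∀ (c : Word (ℕ.suc (ℕ.suc k)) n → Fin r) → ∃ (Monochromatic c) ⊎ Focused c s)
focusing k r hj zero = 0 , λ c → inj₂ record
  { focus            = []
  ; line             = λ ()
  ; moving           = λ ()
  ; focused          = λ ()
  ; colour           = λ ()
  ; coloured         = λ ()
  ; colour-injective = λ { {()} }
  }
focusing k r hj (ℕ.suc s) with n , step ← focusing k r hj s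
  with m , hj-m ← hj (r ^ (ℕ.suc (ℕ.suc k) ^ n)) = m ℕ.+ n , extend
  where
  extend : ∀ (c : Word (ℕ.suc (ℕ.suc k)) (m ℕ.+ n) → Fin r) →
           ∃ (Monochromatic c) ⊎ Focused c (ℕ.suc s)
  extend c = conclude (step c′)
    where
    profile : Word (ℕ.suc k) m → Fin (r ^ (ℕ.suc (ℕ.suc k) ^ n))
    profile v = funToFin (λ i → c (Vec.map fsuc v ++ decode i))
    L = proj₁ (hj-m profile)
    L-moving = proj₁ (proj₂ (hj-m profile))
    γ = proj₁ (proj₂ (proj₂ (hj-m profile)))
    profile-L = proj₂ (proj₂ (proj₂ (hj-m profile)))
    c′ : Word (ℕ.suc (ℕ.suc k)) n → Fin r
    c′ w = finToFun γ (code w)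
    c-L : ∀ x w → c (Vec.map fsuc (L ⟨ x ⟩) ++ w) ≡ c′ w
    c-L x w = begin
      c (Vec.map fsuc (L ⟨ x ⟩) ++ w)                ≡⟨ cong (λ v → c (_ ++ v)) (decode-code w) ⟨
      c (Vec.map fsuc (L ⟨ x ⟩) ++ decode (code w))  ≡⟨ finToFun-funToFin _ (code w) ⟨
      finToFun (profile (L ⟨ x ⟩)) (code w)          ≡⟨ cong (λ p → finToFun p (code w)) (profile-L x) ⟩
      c′ w                                           ∎
      where open ≡-Reasoning
    conclude : ∃ (Monochromatic c′) ⊎ Focused c′ s → ∃ (Monochromatic c) ⊎ Focused c (ℕ.suc s)
    conclude (inj₁ mono) = inj₁ (lift-monochromatic c L L-moving c′ c-L zero mono)
    conclude (inj₂ F) with lift-focused c L L-moving c′ c-L F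
    ... | inj₁ mono = inj₁ (lift-monochromatic c L L-moving c′ c-L zero mono)
    ... | inj₂ F′   = inj₂ F′

halesJewett : ∀ k r → ∃ (HalesJewett (ℕ.suc k) r)
halesJewett zero    r = 1 , λ c → nothing ∷ [] , here refl , c (zero ∷ []) , λ { zero → refl }
-- `suc r` focused lines would need one colour more than there are, which leaves only the
-- monochromatic line.
halesJewett (ℕ.suc k) r with n , step ← focusing k r (halesJewett k) (ℕ.suc r) = n , finish
  where
  finish : HalesJewett (ℕ.suc (ℕ.suc k)) r n
  finish c with step c
  ... | inj₁ mono = mono
  ... | inj₂ F    = contradiction (injective⇒≤ (Focused.colour-injective F)) 1+n≰n

-- Partition regularity of CR-sets

∈-++ˡ : ∀ {m n} {p : Subset m} {p′ : Subset n} {i} → i ∈ₛ p → (i ↑ˡ n) ∈ₛ p ++ p′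
∈-++ˡ {p = p} {p′} {i} i∈ = lookup⇒[]= _ _ (trans (lookup-++ˡ p p′ i) ([]=⇒lookup i∈))

∈-++ʳ : ∀ {m n} (p : Subset m) {p′ : Subset n} {i} → i ∈ₛ p′ → (m ↑ʳ i) ∈ₛ p ++ p′
∈-++ʳ p {p′} {i} i∈ = lookup⇒[]= _ _ (trans (lookup-++ʳ p p′ i) ([]=⇒lookup i∈))

-- Only moving coordinates select rows; the sums over fixed blocks do not vary along the line and go
-- into the starting element.
blocks : ∀ {k n r} → Line k n → Subset r → Subset (n ℕ.* r)
blocks []            H = []
blocks (nothing ∷ L) H = H ++ blocks L H
blocks (just _  ∷ L) H = Subset.⊥ ++ blocks L H

blocks-nonempty : ∀ {k n r} {L : Line k n} {H : Subset r} →
                  nothing ∈ L → Nonempty H → Nonempty (blocks L H)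
blocks-nonempty (here refl) (i , i∈) = _ , ∈-++ˡ i∈
blocks-nonempty {L = nothing ∷ L} {H} (there ∈L) H≠∅ = _ , ∈-++ʳ H (proj₂ (blocks-nonempty ∈L H≠∅))
blocks-nonempty {L = just _ ∷ L} (there ∈L) H≠∅ = _ , ∈-++ʳ Subset.⊥ (proj₂ (blocks-nonempty ∈L H≠∅))

module CombinatoriallyRich {S : Set} {_+_ : Op₂ S}
       (isCommutativeSemigroup : IsCommutativeSemigroup _≡_ _+_) where
  open Semigroup isCommutativeSemigroup using (_+Σ[_]_; IsCR)
  open IsCommutativeSemigroup isCommutativeSemigroup using (assoc; comm)

  +Σ-cong : ∀ {n} {a} (H : Subset n) {f g} → (∀ i → f i ≡ g i) → a +Σ[ H ] f ≡ a +Σ[ H ] g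
  +Σ-cong []                  f≗g = refl
  +Σ-cong {a = a} (true  ∷ H) {g = g} f≗g =
    trans (cong (λ s → (a + s) +Σ[ H ] _) (f≗g zero)) (+Σ-cong H (f≗g ∘ fsuc))
  +Σ-cong (false ∷ H)         f≗g = +Σ-cong H (f≗g ∘ fsuc)

  +Σ-shift : ∀ {n} b a (H : Subset n) f → (b + a) +Σ[ H ] f ≡ b + (a +Σ[ H ] f)
  +Σ-shift b a []          f = refl
  +Σ-shift b a (true  ∷ H) f =
    trans (cong (_+Σ[ H ] _) (assoc b a _)) (+Σ-shift b _ H _)
  +Σ-shift b a (false ∷ H) f = +Σ-shift b a H _

  +Σ-++ : ∀ {m n} {a} (H : Subset m) {K : Subset n} {f} →
          a +Σ[ H ++ K ] f ≡ (a +Σ[ H ] (f ∘ (_↑ˡ n))) +Σ[ K ] (f ∘ (m ↑ʳ_))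
  +Σ-++ []          = refl
  +Σ-++ (true  ∷ H) = +Σ-++ H
  +Σ-++ (false ∷ H) = +Σ-++ H

  +Σ-⊥ : ∀ n {a} {f : Fin n → S} → a +Σ[ Subset.⊥ ] f ≡ a
  +Σ-⊥ zero    = refl
  +Σ-⊥ (ℕ.suc n) = +Σ-⊥ n

  +Σ-shiftʳ : ∀ {n} a b (H : Subset n) f → (a + b) +Σ[ H ] f ≡ (a +Σ[ H ] f) + b
  +Σ-shiftʳ a b H f =
    trans (cong (_+Σ[ H ] f) (comm a b)) (trans (+Σ-shift b a H f) (comm b _))

  +Σ-distrib : ∀ {n} {a} (H : Subset n) {f g} →
               a +Σ[ H ] (λ i → f i + g i) ≡ (a +Σ[ H ] f) +Σ[ H ] g
  +Σ-distrib []                  = refl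
  +Σ-distrib {a = a} (true  ∷ H) {f} {g} = begin
    (a + (f zero + g zero)) +Σ[ H ] _                      ≡⟨ cong (_+Σ[ H ] (λ i → f (fsuc i) + g (fsuc i))) (assoc a _ _) ⟨
    ((a + f zero) + g zero) +Σ[ H ] _                      ≡⟨ +Σ-distrib H ⟩
    (((a + f zero) + g zero) +Σ[ H ] _) +Σ[ H ] _          ≡⟨ cong (_+Σ[ H ] _) (+Σ-shiftʳ (a + f zero) (g zero) H _) ⟩
    (((a + f zero) +Σ[ H ] _) + g zero) +Σ[ H ] _          ∎
    where open ≡-Reasoning
  +Σ-distrib (false ∷ H)         = +Σ-distrib H

  +Σ-swap : ∀ {m n} {a} (H : Subset m) {f} (K : Subset n) {g} →
            (a +Σ[ H ] f) +Σ[ K ] g ≡ (a +Σ[ K ] g) +Σ[ H ] f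
  +Σ-swap []          K = refl
  +Σ-swap {a = a} (true  ∷ H) {f} K {g} =
    trans (+Σ-swap H K) (cong (_+Σ[ H ] _) (+Σ-shiftʳ a (f zero) K g))
  +Σ-swap (false ∷ H) K = +Σ-swap H K

  Rich : ∀ {k r} → Pred S 0ℓ → (Fin r → Fin k → S) → Set
  Rich E M = ∃[ a ] ∃[ H ] (Nonempty H × (∀ j → E (a +Σ[ H ] (λ t → M t j))))

  IsCR-upward : ∀ {E F} → E ⊆ F → IsCR E → IsCR F
  IsCR-upward E⊆F E-cr k 1≤k with r , 1≤r , rich ← E-cr k 1≤k =
    r , 1≤r , λ M → let a , H , H≠∅ , ∈E = rich M in a , H , H≠∅ , λ j → E⊆F (∈E j)

  IsCR-shift : ∀ {E} x → IsCR (λ y → E (x + y)) → IsCR E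
  IsCR-shift {E} x E-cr k 1≤k with r , 1≤r , rich ← E-cr k 1≤k =
    r , 1≤r , λ M → let a , H , H≠∅ , ∈E = rich M in
      x + a , H , H≠∅ , λ j → subst E (sym (+Σ-shift x a H _)) (∈E j)

  ¬IsCR-∅ : S → ¬ IsCR ∅
  ¬IsCR-∅ s ∅-cr = let _ , _ , rich = ∅-cr 1 (s≤s z≤n)
                       _ , _ , _ , ∈∅ = rich (λ _ _ → s)
                   in ∈∅ zero

  module PartitionRegular (em : ExcludedMiddle (suc 0ℓ)) {ε : S}
                          (identityʳ : RightIdentity _≡_ ε _+_) where
    open Classical em using (em₀)

    +Σ-ε : ∀ {n} {a} (H : Subset n) → a +Σ[ H ] (λ _ → ε) ≡ a
    +Σ-ε []          = refl
    +Σ-ε (true  ∷ H) = trans (+Σ-ε H) (identityʳ _)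
    +Σ-ε (false ∷ H) = +Σ-ε H

    -- The n blocks of r rows of M, each read at the column given by the
    -- corresponding letter of the word, and added up.
    wordColumn : ∀ {k r} n → (Fin (n ℕ.* r) → Fin k → S) → Word k n → Fin r → S
    wordColumn _         M []      t = ε
    wordColumn {r = r} (ℕ.suc n) M (x ∷ w) t =
      M (t ↑ˡ n ℕ.* r) x + wordColumn n (M ∘ (r ↑ʳ_)) w t

    -- The block of a fixed letter is added to the starting element before the recursion, hence ends
    -- up in `a′`; the block of a moving letter keeps its rows `H`, read at column `x`.
    wordColumn-line : ∀ {k n r} (M : Fin (n ℕ.* r) → Fin k → S) (L : Line k n) (H : Subset r) a →
      ∃[ a′ ] (∀ x → a +Σ[ H ] wordColumn n M (L ⟨ x ⟩) ≡ a′ +Σ[ blocks L H ] (λ s → M s x))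
    wordColumn-line M [] H a = a , λ x → +Σ-ε H
    wordColumn-line {n = ℕ.suc n} {r} M (just y ∷ L) H a
      with a′ , eq ← wordColumn-line (M ∘ (r ↑ʳ_)) L H (a +Σ[ H ] (λ t → M (t ↑ˡ n ℕ.* r) y))
      = a′ , λ x → begin
        a +Σ[ H ] wordColumn (ℕ.suc n) M (y ∷ L ⟨ x ⟩)                         ≡⟨ +Σ-distrib H ⟩
        _ +Σ[ H ] wordColumn n (M ∘ (r ↑ʳ_)) (L ⟨ x ⟩)                 ≡⟨ eq x ⟩
        a′ +Σ[ blocks L H ] (λ s → M (r ↑ʳ s) x)                     ≡⟨ cong (_+Σ[ blocks L H ] _) (+Σ-⊥ r {f = λ t → M (t ↑ˡ n ℕ.* r) x}) ⟨
        (a′ +Σ[ Subset.⊥ ] (λ t → M (t ↑ˡ n ℕ.* r) x)) +Σ[ blocks L H ] (λ s → M (r ↑ʳ s) x)         ≡⟨ +Σ-++ (Subset.⊥ {r}) ⟨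
        a′ +Σ[ Subset.⊥ ++ blocks L H ] (λ s → M s x)                       ∎
      where open ≡-Reasoning
    wordColumn-line {n = ℕ.suc n} {r} M (nothing ∷ L) H a
      with a′ , eq ← wordColumn-line (M ∘ (r ↑ʳ_)) L H a
      = a′ , λ x → begin
        a +Σ[ H ] wordColumn (ℕ.suc n) M (x ∷ L ⟨ x ⟩)                                  ≡⟨ +Σ-distrib H ⟩
        _ +Σ[ H ] wordColumn n (M ∘ (r ↑ʳ_)) (L ⟨ x ⟩)                          ≡⟨ +Σ-swap H H ⟩
        (a +Σ[ H ] wordColumn n (M ∘ (r ↑ʳ_)) (L ⟨ x ⟩)) +Σ[ H ] _              ≡⟨ cong (_+Σ[ H ] _) (eq x) ⟩
        (a′ +Σ[ blocks L H ] _) +Σ[ H ] _                                     ≡⟨ +Σ-swap (blocks L H) H ⟩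
        (a′ +Σ[ H ] _) +Σ[ blocks L H ] _                                     ≡⟨ +Σ-++ H ⟨
        a′ +Σ[ H ++ blocks L H ] (λ s → M s x)                                ∎
      where open ≡-Reasoning

    nonempty⇒1≤ : ∀ {r} {H : Subset r} → Nonempty H → 1 ≤ r
    nonempty⇒1≤ {ℕ.suc r} _ = s≤s z≤n

    -- The matrix passed to the CR property of `E ∪ F` has one column per word, and a word is
    -- coloured by the set its sum is shown to lie in. One `r` serves all `M`, but the winning set
    -- may vary with `M`.
    rich-split : ∀ {E F} → IsCR (E ∪ F) → ∀ k → 1 ≤ k →
      ∃[ r ] (∀ (M : Fin r → Fin k → S) → Rich E M ⊎ Rich F M)
    rich-split {E} {F} E∪F-cr (ℕ.suc k) _
      with n , hj ← halesJewett k 2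
      with r , _ , rich ← E∪F-cr (ℕ.suc k ℕ.^ n) (m^n>0 (ℕ.suc k) n)
      = n ℕ.* r , split
      where
      which : ∀ {s} → (E ∪ F) s → Fin 2
      which (inj₁ _) = zero
      which (inj₂ _) = fsuc zero
      which-zero : ∀ {s} (e : (E ∪ F) s) → which e ≡ zero → E s
      which-zero (inj₁ e) _ = e
      which-one : ∀ {s} (e : (E ∪ F) s) → which e ≡ fsuc zero → F s
      which-one (inj₂ f) _ = f
      split : ∀ M → Rich E M ⊎ Rich F M
      split M
        with a , H , H≠∅ , ∈E∪F ← rich (λ t j → wordColumn n M (decode {ℕ.suc k} j) t)
        with L , L-moving , γ , mono ← hj (λ w → which (∈E∪F (code w)))
        with a′ , eq ← wordColumn-line M L H a
        = conclude γ mono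
        where
        at : ∀ x → a +Σ[ H ] wordColumn n M (decode {n = n} (code (L ⟨ x ⟩))) ≡
                   a′ +Σ[ blocks L H ] (λ s → M s x)
        at x = trans (cong (λ w → a +Σ[ H ] wordColumn n M w) (decode-code (L ⟨ x ⟩))) (eq x)
        H′≠∅ = blocks-nonempty L-moving H≠∅
        conclude : ∀ γ → (∀ x → which (∈E∪F (code (L ⟨ x ⟩))) ≡ γ) → Rich E M ⊎ Rich F M
        conclude zero        mono = inj₁ (a′ , blocks L H , H′≠∅ , λ x →
          subst E (at x) (which-zero (∈E∪F (code (L ⟨ x ⟩))) (mono x)))
        conclude (fsuc zero) mono = inj₂ (a′ , blocks L H , H′≠∅ , λ x →
          subst F (at x) (which-one (∈E∪F (code (L ⟨ x ⟩))) (mono x)))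

    -- If `E` fails for `k` columns and `F` for `k′`, a bad matrix for each, placed side by side,
    -- contradicts `rich-split` for `k + k′` columns.
    partition-regular : ∀ {E F} → IsCR (E ∪ F) → IsCR E ⊎ IsCR F
    partition-regular {E} {F} E∪F-cr with em₀ {IsCR E}
    ... | yes E-cr = inj₁ E-cr
    ... | no ¬E-cr = inj₂ F-cr
      where
      F-cr : IsCR F
      F-cr k′ 1≤k′ = decidable-stable em₀ λ ¬F → ¬E-cr λ k 1≤k →
        decidable-stable em₀ λ ¬E → refute k 1≤k ¬E ¬F
        where
        refute : ∀ k → 1 ≤ k →
          ¬ (∃[ r ] (1 ≤ r × (∀ (M : Fin r → Fin k → S) → Rich E M))) →
          ¬ ¬ (∃[ r ] (1 ≤ r × (∀ (M : Fin r → Fin k′ → S) → Rich F M)))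
        refute k 1≤k ¬E ¬F with r , split ← rich-split {E} {F} E∪F-cr (k ℕ.+ k′) (m≤n⇒m≤n+o k′ 1≤k) =
          ¬E (r , 1≤r , λ M → decidable-stable em₀ λ ¬rich-M →
            ¬F (r , 1≤r , λ M′ → [ (λ rich → contradiction (left M M′ rich) ¬rich-M) , right M M′ ]′
                                   (split (M ∥ M′))))
          where
          1≤r : 1 ≤ r
          -- Any matrix serves: the nonempty set of rows it yields forces `r` to be positive.
          1≤r with split (λ _ _ → ε)
          ... | inj₁ (_ , _ , H≠∅ , _) = nonempty⇒1≤ H≠∅
          ... | inj₂ (_ , _ , H≠∅ , _) = nonempty⇒1≤ H≠∅
          _∥_ : (Fin r → Fin k → S) → (Fin r → Fin k′ → S) → Fin r → Fin (k ℕ.+ k′) → S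
          (M ∥ M′) t j = [ M t , M′ t ]′ (splitAt k j)
          left : ∀ M M′ → Rich E (M ∥ M′) → Rich E M
          left M M′ (a , H , H≠∅ , ∈E) = a , H , H≠∅ , λ j → subst E
            (+Σ-cong H λ t → cong [ M t , M′ t ]′ (splitAt-↑ˡ k j k′)) (∈E (j ↑ˡ k′))
          right : ∀ M M′ → Rich F (M ∥ M′) → Rich F M′
          right M M′ (a , H , H≠∅ , ∈F) = a , H , H≠∅ , λ j → subst F
            (+Σ-cong H λ t → cong [ M t , M′ t ]′ (splitAt-↑ʳ k k′ j)) (∈F (k ↑ʳ j))

-- Preimages under a rational matrix

/1-homo-+ : ∀ m n → (m ℤ.+ n) ℚ./ 1 ≡ m ℚ./ 1 ℚ.+ n ℚ./ 1
/1-homo-+ m n = ℚₚ.toℚᵘ-injective (begin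
  toℚᵘ ((m ℤ.+ n) ℚ./ 1)                   ≈⟨ ℚₚ.toℚᵘ-fromℚᵘ (mkℚᵘ (m ℤ.+ n) 0) ⟩
  mkℚᵘ (m ℤ.+ n) 0                         ≡⟨ cong (λ i → mkℚᵘ i 0) (cong₂ ℤ._+_ (ℤₚ.*-identityʳ m) (ℤₚ.*-identityʳ n)) ⟨
  mkℚᵘ m 0 ℚᵘ.+ mkℚᵘ n 0                   ≈⟨ ℚᵘₚ.+-cong (ℚₚ.toℚᵘ-fromℚᵘ (mkℚᵘ m 0)) (ℚₚ.toℚᵘ-fromℚᵘ (mkℚᵘ n 0)) ⟨
  toℚᵘ (m ℚ./ 1) ℚᵘ.+ toℚᵘ (n ℚ./ 1)       ≈⟨ ℚₚ.toℚᵘ-homo-+ (m ℚ./ 1) (n ℚ./ 1) ⟨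
  toℚᵘ (m ℚ./ 1 ℚ.+ n ℚ./ 1)               ∎)
  where open ℚᵘₚ.≃-Reasoning

·-distrib-+ : ∀ {u v} (A : Fin u → Fin v → ℚ) (x y : Vec ℤ v) i →
              (A · zipWith ℤ._+_ x y) i ≡ (A · x) i ℚ.+ (A · y) i
·-distrib-+ A x y i = trans (sum-cong-≗ term) (∑-distrib-+ ℚₚ.+-0-commutativeMonoid
  (λ j → A i j ℚ.* (lookup x j ℚ./ 1)) (λ j → A i j ℚ.* (lookup y j ℚ./ 1)))
  where
  open ≡-Reasoning
  term : ∀ j → A i j ℚ.* (lookup (zipWith ℤ._+_ x y) j ℚ./ 1) ≡
               A i j ℚ.* (lookup x j ℚ./ 1) ℚ.+ A i j ℚ.* (lookup y j ℚ./ 1)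
  term j = begin
    A i j ℚ.* (lookup (zipWith ℤ._+_ x y) j ℚ./ 1)            ≡⟨ cong (λ z → A i j ℚ.* (z ℚ./ 1)) (lookup-zipWith ℤ._+_ j x y) ⟩
    A i j ℚ.* ((lookup x j ℤ.+ lookup y j) ℚ./ 1)             ≡⟨ cong (A i j ℚ.*_) (/1-homo-+ (lookup x j) (lookup y j)) ⟩
    A i j ℚ.* (lookup x j ℚ./ 1 ℚ.+ lookup y j ℚ./ 1)         ≡⟨ ℚₚ.*-distribˡ-+ (A i j) _ _ ⟩
    _                                                         ∎

-- Handles all rows of the matrix at once: each entry of A x gives its own translate of B in `p`.
⋂-member : ∀ {S : Set} (p : Ultrafilter S) {n} (E : Fin n → Pred S 0ℓ) →
           (∀ i → member p (E i)) → member p (λ x → ∀ i → E i x)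
⋂-member p {ℕ.zero}  E E∈ = upward (λ _ ()) whole
  where open Ultrafilter p
⋂-member p {ℕ.suc n} E E∈ =
  upward (λ { (e , es) zero → e ; (e , es) (fsuc i) → es i })
         (intersect (E∈ zero) (⋂-member p (E ∘ fsuc) (E∈ ∘ fsuc)))
  where open Ultrafilter p

-- The two idempotent filters and their join

module _ (em : ExcludedMiddle (suc 0ℓ)) (ext : Extensionality (suc 0ℓ) (suc 0ℓ))
         {u v} (A : Fin u → Fin v → ℚ) where
  open Classical em
  open FilterProperties em ext {Vec ℤ v}
  open IdempotentExtension em ext (ℤ^-isCommutativeSemigroup v)
  open CombinatoriallyRich (ℤ^-isCommutativeSemigroup v)
  open PartitionRegular em (zipWith-identityʳ ℤₚ.+-identityʳ)
  open ℤ^+ v using (IsCR)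

  preimage-mono : ∀ {B C} → B ⊆ C → preimage A B ⊆ preimage A C
  preimage-mono B⊆C Ay∈B i = let z , z∈B , eq = Ay∈B i in z , B⊆C z∈B , eq

  -- The filter dual to the ideal of sets that are not CR; the ultrafilters containing it are
  -- exactly the points of CR(ℤᵛ).
  CoCR : Pred (Pred (Vec ℤ v) 0ℓ) 0ℓ
  CoCR D = ¬ IsCR (∁ D)

  coCR-isIdempotentFilter : IsIdempotentFilter CoCR
  coCR-isIdempotentFilter = record
    { isFilter = record
      { whole     = whole
      ; upward    = upward
      ; intersect = λ {D} {E} ¬D ¬E D∩E →
          [ ¬D , ¬E ]′ (partition-regular {∁ D} {∁ E} (IsCR-upward {∁ (D ∩ E)} {∁ D ∪ ∁ E} (λ {x} → split {D} {E} {x}) D∩E))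
      }
    -- A translate of a set that is not CR is not CR, so -x + D is in the filter for every x.
    ; idempotent = λ {D} ¬D → upward {U} (λ {x} _ D-x → ¬D (IsCR-shift {∁ D} x D-x)) whole
    }
    where
    whole : CoCR U
    whole U-cr = ¬IsCR-∅ (replicate v (ℤ.+ 0)) (IsCR-upward {∁ U} (λ ¬tt → ¬tt _) U-cr)
    upward : ∀ {D E} → D ⊆ E → CoCR D → CoCR E
    upward {D} {E} D⊆E ¬D E-cr = ¬D (IsCR-upward {∁ E} {∁ D} (λ ¬e d → ¬e (D⊆E d)) E-cr)
    split : ∀ {D E : Pred (Vec ℤ v) 0ℓ} → ∁ (D ∩ E) ⊆ ∁ D ∪ ∁ E
    split {D} {E} {x} ¬de with em₀ {D x}
    ... | yes d = inj₂ λ e → ¬de (d , e)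
    ... | no ¬d = inj₁ ¬d

  module _ (p : Ultrafilter ℤ) (p-idempotent : ℤ+.IsIdempotent p) where
    private module p = Ultrafilter p

    Preimages : Pred (Pred (Vec ℤ v) 0ℓ) 0ℓ
    Preimages D = Resize (∃[ B ] (p.member B × preimage A B ⊆ D))

    preimages-isIdempotentFilter : IsIdempotentFilter Preimages
    preimages-isIdempotentFilter = record
      { isFilter = record
        { whole     = resize (U , p.whole , _)
        ; upward    = λ D⊆E D∈ → let B , B∈ , B⊆D = unresize D∈ in
                        resize (B , B∈ , λ {y} y∈ → D⊆E {y} (B⊆D y∈))
        ; intersect = λ D∈ E∈ →
            let B , B∈ , B⊆D = unresize D∈
                C , C∈ , C⊆E = unresize E∈
            in resize (B ∩ C , p.intersect B∈ C∈ , λ {y} y∈ →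
                 B⊆D {y} (preimage-mono {B ∩ C} {B} proj₁ {y} y∈) ,
                 C⊆E {y} (preimage-mono {B ∩ C} {C} proj₂ {y} y∈))
        }
      -- By p = p + p the z with -z + B in `p` form a member of `p`. For x in its preimage, the
      -- intersection of the -z + B over the entries z of A x is in `p`, and adding to x any y from
      -- the preimage of that intersection lands in the preimage of `B`.
      ; idempotent = λ {D} D∈ → let B , B∈ , B⊆D = unresize D∈ in
          resize (_ , proj₁ p-idempotent B∈ , λ {x} x∈ →
            resize (_ , ⋂-member p _ (λ i → proj₁ (proj₂ (x∈ i))) , λ {y} y∈ →
              B⊆D (sum-preimage {B} x y x∈ y∈)))
      }
      where
      sum-preimage : ∀ {B} x y (x∈ : preimage A (λ z → p.member (λ w → B (z ℤ.+ w))) x) →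
        preimage A (λ w → ∀ i → B (proj₁ (x∈ i) ℤ.+ w)) y →
        preimage A B (zipWith ℤ._+_ x y)
      sum-preimage x y x∈ y∈ i =
        let z , _ , Ax≡z = x∈ i
            w , w∈ , Ay≡w = y∈ i
        in z ℤ.+ w , w∈ i ,
           trans (·-distrib-+ A x y i) (trans (cong₂ ℚ._+_ Ax≡z Ay≡w) (sym (/1-homo-+ z w)))

    -- Were `D` and `E` disjoint, `∁ E` would contain the CR-set `preimage A B` and be CR itself.
    preimages∨coCR-proper : (∀ B → p.member B → IsCR (preimage A B)) →
                            Proper (Preimages ∨ CoCR)
    preimages∨coCR-proper preimage-cr = ∨-proper meets
      where
      meets : ∀ {D E} → Preimages D → CoCR E → ¬ (D ∩ E ⊆ ∅)
      meets {D} {E} D∈ ¬E D∩E⊆∅ = let B , B∈ , B⊆D = unresize D∈ in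
        ¬E (IsCR-upward {preimage A B} {∁ E} (λ {y} y∈ e → D∩E⊆∅ {y} (B⊆D {y} y∈ , e)) (preimage-cr B B∈))

    preimage-essential : (∀ B → p.member B → IsCR (preimage A B)) →
                         ∀ C → p.member C → ℤ^+.IsEssentialCR v (preimage A C)
    preimage-essential preimage-cr C C∈ =
      q , q-idempotent , F⊆q C∈F , q-cr
      where
      isP = IsIdempotentFilter.isFilter preimages-isIdempotentFilter
      isN = IsIdempotentFilter.isFilter coCR-isIdempotentFilter
      extension = idempotent-extension
        (∨-isIdempotentFilter preimages-isIdempotentFilter coCR-isIdempotentFilter)
        (preimages∨coCR-proper preimage-cr)
      q = proj₁ extension
      q-idempotent = proj₁ (proj₂ extension)
      F⊆q : Preimages ∨ CoCR ⊆ member q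
      F⊆q = proj₂ (proj₂ extension)
      C∈F : (Preimages ∨ CoCR) (preimage A C)
      C∈F = ⊆∨ˡ isP isN (resize (C , C∈ , λ {y} → id))
      q-cr : member q ⊆ IsCR
      -- If `E` were not CR, `∁ E` would lie in `CoCR` and so in `q` along with `E`.
      q-cr {E} E∈ = decidable-stable em₀ λ ¬E → not-both q E E∈ (F⊆q (⊆∨ʳ isP isN {∁ E}
        λ ∁∁E-cr → ¬E (IsCR-upward {∁ (∁ E)} (λ ¬¬e → decidable-stable em₀ ¬¬e) ∁∁E-cr)))

theorem2p7 : ExcludedMiddle (suc 0ℓ) →
    Extensionality (suc 0ℓ) (suc 0ℓ) →
    ∀ (u v : ℕ) → 1 ≤ u → 1 ≤ v →
    ∀ (A : Fin u → Fin v → ℚ) →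
    (∀ (B : Pred ℤ 0ℓ) → ℤ+.IsCR B → ℤ^+.IsCR v (preimage A B)) →
    ∀ (C : Pred ℤ 0ℓ) → ℤ+.IsEssentialCR C →
    ℤ^+.IsEssentialCR v (preimage A C)
theorem2p7 em ext u v _ _ A preimage-cr C (p , p-idempotent , C∈ , p-cr) =
  -- Every `B` in `p` is CR because p lies in CR(ℤ), so the hypothesis on preimages applies to it.
  preimage-essential em ext A p p-idempotent (λ B B∈ → preimage-cr B (p-cr B∈)) C C∈
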